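{- Let $\langle A,\to\rangle$ be a conditional algebra and let $B$ be (the domain of) a Boolean subalgebra of $A$. Then the following are equivalent: (1) $E_B$ is a C-equivalence on the expanded Stone space $\langle\mathrm{Ul}(A),\tau_s,T_A\rangle$; (2) $B$ is closed under $\to$, i.e., $\langle B,\to\rangle$ is a subalgebra of $\langle A,\to\rangle$.
   Context: A conditional algebra is $\langle A,\to\rangle$ with $A$ a Boolean algebra and $\to$ binary with $a\to1=1$, $(a\to b)\wedge(a\to c)=a\to(b\wedge c)$, $(a\vee b)\to c\le(a\to c)\wedge(b\to c)$. $\mathrm{Ul}(A)$ is the Stone space of ultrafilters (closed sets are exactly the sets $\varphi(F)=\{u:F\subseteq u\}$, $F$ a filter, the improper filter $A$ included). $D^{\to}_u(F)=\{b:\exists a\in F,\ a\to b\in u\}$; $T_A(u,Z,v)$ iff there is a filter $F$ with $Z=\varphi(F)$ and $D^{\to}_u(F)\subseteq v$. $E_B=\{(u,v)\in\mathrm{Ul}(A)^2: u\cap B=v\cap B\}$. For an equivalence $E$ on a space $X$ with relation $T$ and closed sets $Y,C$: $Y\preceq_E C$ iff for every $y\in Y$ there is $x\in C$ with $E(x,y)$. $E$ is a C-equivalence if $E$ is a Boolean equivalence (for each $(x,y)\notin E$ there is a clopen set closed under $E$ containing $x$ but not $y$) and for all $x,x',y\in X$ and closed $Y$, if $E(x,y)$ and $T(x,Y,x')$ then there exist $y'$ with $E(x',y')$ and closed $C$ with $T(y,C,y')$ and $C\preceq_E Y$. -}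

module Defs where

open import Level using (_⊔_) renaming (suc to lsuc)
open import Data.Product using (Σ; ∃-syntax; _×_; _,_; proj₁; proj₂)
open import Data.Sum using (_⊎_)
open import Data.Unit.Polymorphic using () renaming (⊤ to ⊤ₚ)
open import Relation.Nullary using (¬_)
open import Relation.Unary using (Pred; _∈_; _∉_; _⊆_; _≐_; _∩_; ∁; ⋃)
open import Relation.Binary using (Rel; Poset; IsEquivalence)
open import Algebra.Core using (Op₂)
open import Algebra.Definitions using (Congruent₂)
open import Algebra.Lattice.Bundles using (BooleanAlgebra)
import Algebra.Lattice.Properties.BooleanAlgebra as BooleanAlgebraProperties

-- Zorn's lemma and the library's ExcludedMiddle make the
-- classical metatheory (ZFC) explicit: separating points of a Boolean
-- algebra by ultrafilters needs a choice principle.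

module _ {a ℓ₁ ℓ₂} (P : Poset a ℓ₁ ℓ₂) where
  open Poset P

  IsChain : ∀ {k} → Pred Carrier k → Set (a ⊔ ℓ₂ ⊔ k)
  IsChain C = ∀ {x y} → x ∈ C → y ∈ C → x ≤ y ⊎ y ≤ x

  IsUpperBound : ∀ {k} → Pred Carrier k → Carrier → Set (a ⊔ ℓ₂ ⊔ k)
  IsUpperBound C b = ∀ {x} → x ∈ C → x ≤ b

  IsMaximal : Carrier → Set (a ⊔ ℓ₁ ⊔ ℓ₂)
  IsMaximal m = ∀ {x} → m ≤ x → x ≈ m

ZornsLemma : ∀ ℓ → Set (lsuc ℓ)
ZornsLemma ℓ = (P : Poset ℓ ℓ ℓ) →
  ((C : Pred (Poset.Carrier P) ℓ) → IsChain P C → ∃[ b ] IsUpperBound P C b) →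
  ∃[ m ] IsMaximal P m


record TopologicalSpace x q r : Set (lsuc (x ⊔ q ⊔ r)) where
  field
    Point       : Set x
    IsOpen      : Pred (Pred Point q) r
    open-resp-≐ : ∀ {V W} → V ≐ W → IsOpen V → IsOpen W
    open-U      : IsOpen (λ _ → ⊤ₚ {q})
    open-∩      : ∀ {V W} → IsOpen V → IsOpen W → IsOpen (V ∩ W)
    open-⋃      : ∀ {I : Set q} {V : I → Pred Point q} →
                  (∀ i → IsOpen (V i)) → IsOpen (⋃ I V)

  IsClosed : Pred (Pred Point q) r
  IsClosed C = IsOpen (∁ C)

  IsClopen : Pred (Pred Point q) r
  IsClopen C = IsOpen C × IsClosed C

record ExpandedSpace x q r t : Set (lsuc (x ⊔ q ⊔ r ⊔ t)) where
  field
    space : TopologicalSpace x q r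

  open TopologicalSpace space public

  field
    -- Only the values at closed sets are ever used.
    T : Point → Pred Point q → Point → Set t

module _ {x q r t} (X : ExpandedSpace x q r t) where
  open ExpandedSpace X

  Preceq : ∀ {e} → Rel Point e → Pred Point q → Pred Point q → Set (x ⊔ q ⊔ e)
  Preceq E Y C = ∀ y → y ∈ Y → ∃[ x ] x ∈ C × E x y

  IsSaturated : ∀ {e} → Rel Point e → Pred Point q → Set (x ⊔ q ⊔ e)
  IsSaturated E V = ∀ {x y} → E x y → x ∈ V → y ∈ V

  record IsBooleanEquivalence {e} (E : Rel Point e) : Set (x ⊔ lsuc q ⊔ r ⊔ e) where
    field
      isEquivalence : IsEquivalence E
      separates     : ∀ x y → ¬ E x y →
                      ∃[ V ] IsClopen V × IsSaturated E V × x ∈ V × y ∉ V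

  record IsCEquivalence {e} (E : Rel Point e) : Set (x ⊔ lsuc q ⊔ r ⊔ t ⊔ e) where
    field
      isBooleanEquivalence : IsBooleanEquivalence E
      back : ∀ x x′ y Y → IsClosed Y → E x y → T x Y x′ →
             ∃[ y′ ] E x′ y′ × (∃[ C ] IsClosed C × T y C y′ × Preceq E C Y)


record ConditionalAlgebra c ℓ : Set (lsuc (c ⊔ ℓ)) where
  infixr 5 _⇒_
  field
    booleanAlgebra : BooleanAlgebra c ℓ

  open BooleanAlgebra booleanAlgebra public renaming (¬_ to ∼_)
  open Poset (BooleanAlgebraProperties.poset booleanAlgebra) public using (_≤_)

  field
    _⇒_         : Op₂ Carrier
    ⇒-cong      : Congruent₂ _≈_ _⇒_
    ⇒-⊤         : ∀ a → (a ⇒ ⊤) ≈ ⊤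
    ⇒-∧         : ∀ a b c → ((a ⇒ b) ∧ (a ⇒ c)) ≈ (a ⇒ (b ∧ c))
    ∨-⇒         : ∀ a b c → ((a ∨ b) ⇒ c) ≤ ((a ⇒ c) ∧ (b ⇒ c))

module _ {c ℓ} (A : ConditionalAlgebra c ℓ) where
  open ConditionalAlgebra A

  record IsBooleanSubalgebra {b} (B : Pred Carrier b) : Set (c ⊔ ℓ ⊔ b) where
    field
      resp-≈   : ∀ {x y} → x ≈ y → x ∈ B → y ∈ B
      ⊤-closed : ⊤ ∈ B
      ⊥-closed : ⊥ ∈ B
      ∧-closed : ∀ {x y} → x ∈ B → y ∈ B → (x ∧ y) ∈ B
      ∨-closed : ∀ {x y} → x ∈ B → y ∈ B → (x ∨ y) ∈ B
      ∼-closed : ∀ {x} → x ∈ B → (∼ x) ∈ B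

  ClosedUnder⇒ : ∀ {b} → Pred Carrier b → Set (c ⊔ b)
  ClosedUnder⇒ B = ∀ {x y} → x ∈ B → y ∈ B → (x ⇒ y) ∈ B

  Subset : Set (lsuc (c ⊔ ℓ))
  Subset = Pred Carrier (c ⊔ ℓ)

  -- The improper filter is allowed. Invariance under _≈_ follows from ↑-closed.
  record IsFilter (F : Subset) : Set (c ⊔ ℓ) where
    field
      ⊤∈F      : ⊤ ∈ F
      ∧-closed : ∀ {x y} → x ∈ F → y ∈ F → (x ∧ y) ∈ F
      ↑-closed : ∀ {x y} → x ≤ y → x ∈ F → y ∈ F

  record IsUltrafilter (u : Subset) : Set (lsuc (c ⊔ ℓ)) where
    field
      isFilter : IsFilter u
      proper   : ⊥ ∉ u
      maximal  : ∀ (F : Subset) → IsFilter F → ⊥ ∉ F → u ⊆ F → F ⊆ u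

  -- Points are compared by _≐_ on their underlying subsets; every notion below
  -- respects this, in particular all open sets do.
  Ul : Set (lsuc (c ⊔ ℓ))
  Ul = Σ Subset IsUltrafilter

  φ : Subset → Pred Ul (c ⊔ ℓ)
  φ F (u , _) = F ⊆ u

  -- The topology with base { u | a ∈ u }, a in A.
  IsStoneOpen : Pred (Pred Ul (c ⊔ ℓ)) (lsuc (c ⊔ ℓ))
  IsStoneOpen V = ∀ u → u ∈ V → ∃[ a ] a ∈ proj₁ u × (∀ v → a ∈ proj₁ v → v ∈ V)

  stoneSpace : TopologicalSpace (lsuc (c ⊔ ℓ)) (c ⊔ ℓ) (lsuc (c ⊔ ℓ))
  stoneSpace = record
    { Point       = Ul
    ; IsOpen      = IsStoneOpen
    ; open-resp-≐ = λ (V⊆W , W⊆V) oV u u∈W →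
        let (a , a∈u , h) = oV u (W⊆V u∈W) in a , a∈u , λ v a∈v → V⊆W (h v a∈v)
    ; open-U      = λ (u , uf) _ →
        ⊤ , IsFilter.⊤∈F (IsUltrafilter.isFilter uf) , _
    ; open-∩      = λ oV oW u (u∈V , u∈W) →
        let (a , a∈u , h) = oV u u∈V
            (b , b∈u , k) = oW u u∈W
        in a ∧ b
         , IsFilter.∧-closed (IsUltrafilter.isFilter (proj₂ u)) a∈u b∈u
         , λ v ab∈v → let ↑ = IsFilter.↑-closed (IsUltrafilter.isFilter (proj₂ v)) in
             h v (↑ (∧≤ˡ a b) ab∈v) , k v (↑ (∧≤ʳ a b) ab∈v)
    ; open-⋃      = λ oV u (i , u∈Vi) →
        let (a , a∈u , h) = oV i u u∈Vi in a , a∈u , λ v a∈v → i , h v a∈v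
    }
    where
    open import Relation.Binary.Lattice using (Lattice)
    open Lattice (BooleanAlgebraProperties.∨-∧-orderTheoreticLattice booleanAlgebra)
      using () renaming (x∧y≤x to ∧≤ˡ; x∧y≤y to ∧≤ʳ)

  D⇒ : Subset → Subset → Pred Carrier (c ⊔ ℓ)
  D⇒ u F b = ∃[ a ] a ∈ F × (a ⇒ b) ∈ u

  T-rel : Ul → Pred Ul (c ⊔ ℓ) → Ul → Set (lsuc (c ⊔ ℓ))
  T-rel (u , _) Z (v , _) = ∃[ F ] IsFilter F × Z ≐ φ F × D⇒ u F ⊆ v

  expandedStoneSpace :
    ExpandedSpace (lsuc (c ⊔ ℓ)) (c ⊔ ℓ) (lsuc (c ⊔ ℓ)) (lsuc (c ⊔ ℓ))
  expandedStoneSpace = record { space = stoneSpace ; T = T-rel }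

  E[_] : Subset → Rel Ul (c ⊔ ℓ)
  E[ B ] (u , _) (v , _) = (u ∩ B) ≐ (v ∩ B)

{-# OPTIONS --safe #-}

-- The engine is an extension lemma: if a filter F satisfies F ∩ B ⊆ w for an
-- ultrafilter w, then some ultrafilter z ⊇ F agrees with w on B, because
-- F ∪ (w ∩ B) has the finite intersection property.
--
-- If B is closed under ⇒ and T(x, φ(F), x′), put G = ↑(F ∩ B).  The lemma for F
-- gives φ(G) ⪯ φ(F), and the lemma for the filter D_y(G) and x′ gives y′.
--
-- Conversely, if a, b ∈ B but a ⇒ b ∉ B, there are x, y agreeing on B with
-- a ⇒ b ∈ x and a ⇒ b ∉ y.  Choose y′ ⊇ D_y(↑a) omitting b.  The back condition
-- gives φ(G) ⪯ φ(↑a) and D_x(G) ⊆ x′ with x′ and y′ agreeing on B; then a ∈ G,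
-- so b ∈ x′ and hence b ∈ y′, a contradiction.
module Submission where

open import Level using (Level; _⊔_; Lift; lift; lower) renaming (suc to lsuc)
open import Axiom.ExcludedMiddle using (ExcludedMiddle)
open import Data.Empty using (⊥-elim)
open import Data.Product using (∃-syntax; _×_; _,_; proj₁; proj₂; swap)
open import Data.Sum using (inj₁; inj₂)
open import Function.Base using (id)
open import Function.Bundles using (_⇔_; mk⇔)
open import Relation.Binary using (Poset)
open import Relation.Binary.Lattice using (Lattice)
open import Relation.Nullary using (¬_; yes; no)
open import Relation.Nullary.Decidable using (True; toWitness; fromWitness; map′; decidable-stable)
open import Relation.Unary using (Pred; _∈_; _∉_; _⊆_; _≐_; _∩_)
import Algebra.Lattice.Properties.BooleanAlgebra as BooleanAlgebraProperties
open import Defs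

-- Order laws and monotonicity of the conditional.

module ConditionalAlgebraProperties {c ℓ : Level} (A : ConditionalAlgebra c ℓ) where
  open ConditionalAlgebra A
  open BooleanAlgebraProperties booleanAlgebra using (∧-identityʳ; ∧-zeroˡ; ¬-involutive; ∨-∧-orderTheoreticLattice)
  open Lattice ∨-∧-orderTheoreticLattice public
    using (x∧y≤x; x∧y≤y; ∧-greatest; ∨-least; y≤x∨y; antisym)
    renaming (refl to ≤-refl; trans to ≤-trans; reflexive to ≤-reflexive)

  ⊥-minimum : ∀ x → ⊥ ≤ x
  ⊥-minimum x = sym (∧-zeroˡ x)

  ⊤-maximum : ∀ x → x ≤ ⊤
  ⊤-maximum x = sym (∧-identityʳ x)

  ∧-mono : ∀ {x y z w} → x ≤ y → z ≤ w → (x ∧ z) ≤ (y ∧ w)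
  ∧-mono x≤y z≤w =
    ∧-greatest (≤-trans (x∧y≤x _ _) x≤y) (≤-trans (x∧y≤y _ _) z≤w)

  disjoint⇒≤∼ : ∀ {x y} → (x ∧ y) ≤ ⊥ → x ≤ (∼ y)
  disjoint⇒≤∼ {x} {y} x∧y≤⊥ = ≤-trans
    (≤-reflexive (trans (sym (∧-identityʳ x))
      (trans (∧-congˡ (sym (∨-complementʳ y))) (∧-distribˡ-∨ x y (∼ y)))))
    (∨-least (≤-trans x∧y≤⊥ (⊥-minimum _)) (x∧y≤y _ _))

  disjoint-∼⇒≤ : ∀ {x y} → (x ∧ (∼ y)) ≤ ⊥ → x ≤ y
  disjoint-∼⇒≤ p = ≤-trans (disjoint⇒≤∼ p) (≤-reflexive (¬-involutive _))

  -- Since `x ≤ y` unfolds to `x ≈ x ∧ y`, this is the meet law read as an inequality.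
  ⇒-monoʳ : ∀ {a x y} → x ≤ y → (a ⇒ x) ≤ (a ⇒ y)
  ⇒-monoʳ x≤y = trans (⇒-cong refl x≤y) (sym (⇒-∧ _ _ _))

  ⇒-antiˡ : ∀ {a b x} → a ≤ b → (b ⇒ x) ≤ (a ⇒ x)
  ⇒-antiˡ a≤b = ≤-trans
    (≤-reflexive (⇒-cong (antisym (y≤x∨y _ _) (∨-least a≤b ≤-refl)) refl))
    (≤-trans (∨-⇒ _ _ _) (x∧y≤x _ _))

-- Filters, filter bases and ultrafilters.

module Filters {c ℓ : Level} (A : ConditionalAlgebra c ℓ) where
  open ConditionalAlgebra A
  open ConditionalAlgebraProperties A

  -- Upward closure is dropped because traces such as `F ∩ B` on a subalgebra need not have it.
  record IsFilterBase (S : Subset A) : Set (c ⊔ ℓ) where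
    field
      ⊤∈S      : ⊤ ∈ S
      ∧-closed : ∀ {x y} → x ∈ S → y ∈ S → (x ∧ y) ∈ S

  filter⇒base : ∀ {F} → IsFilter A F → IsFilterBase F
  filter⇒base isF = record { ⊤∈S = ⊤∈F ; ∧-closed = ∧-closed }
    where open IsFilter isF

  ∩-isFilterBase : ∀ {S R} → IsFilterBase S → IsFilterBase R → IsFilterBase (S ∩ R)
  ∩-isFilterBase s r = record
    { ⊤∈S      = S.⊤∈S , R.⊤∈S
    ; ∧-closed = λ (x∈S , x∈R) (y∈S , y∈R) → S.∧-closed x∈S y∈S , R.∧-closed x∈R y∈R
    }
    where
    module S = IsFilterBase s
    module R = IsFilterBase r

  ↑ : Subset A → Subset A
  ↑ S x = ∃[ s ] s ∈ S × s ≤ x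

  ↑-isFilter : ∀ {S} → IsFilterBase S → IsFilter A (↑ S)
  ↑-isFilter base = record
    { ⊤∈F      = ⊤ , ⊤∈S , ≤-refl
    ; ∧-closed = λ (s , s∈S , s≤x) (t , t∈S , t≤y) → s ∧ t , ∧-closed s∈S t∈S , ∧-mono s≤x t≤y
    ; ↑-closed = λ x≤y (s , s∈S , s≤x) → s , s∈S , ≤-trans s≤x x≤y
    }
    where open IsFilterBase base

  principal : Carrier → Subset A
  principal a x = Lift (c ⊔ ℓ) (a ≤ x)

  principal-isFilter : ∀ a → IsFilter A (principal a)
  principal-isFilter a = record
    { ⊤∈F      = lift (⊤-maximum a)
    ; ∧-closed = λ (lift a≤x) (lift a≤y) → lift (∧-greatest a≤x a≤y)
    ; ↑-closed = λ x≤y (lift a≤x) → lift (≤-trans a≤x x≤y)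
    }

  -- For filter bases this is the filter generated by their union.
  _∨ᶠ_ : Subset A → Subset A → Subset A
  (S ∨ᶠ R) x = ∃[ s ] ∃[ r ] s ∈ S × r ∈ R × (s ∧ r) ≤ x

  module _ {S R : Subset A} (baseS : IsFilterBase S) (baseR : IsFilterBase R) where
    private
      module S = IsFilterBase baseS
      module R = IsFilterBase baseR

    ∨ᶠ-isFilter : IsFilter A (S ∨ᶠ R)
    ∨ᶠ-isFilter = record
      { ⊤∈F      = ⊤ , ⊤ , S.⊤∈S , R.⊤∈S , ⊤-maximum _
      ; ∧-closed = λ (s , r , s∈S , r∈R , p) (s′ , r′ , s′∈S , r′∈R , p′) →
          s ∧ s′ , r ∧ r′ , S.∧-closed s∈S s′∈S , R.∧-closed r∈R r′∈R
          , ∧-greatest (≤-trans (∧-mono (x∧y≤x _ _) (x∧y≤x _ _)) p)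
                       (≤-trans (∧-mono (x∧y≤y _ _) (x∧y≤y _ _)) p′)
      ; ↑-closed = λ x≤y (s , r , s∈S , r∈R , p) → s , r , s∈S , r∈R , ≤-trans p x≤y
      }

    ⊆-∨ᶠˡ : S ⊆ (S ∨ᶠ R)
    ⊆-∨ᶠˡ {x} x∈S = x , ⊤ , x∈S , R.⊤∈S , x∧y≤x _ _

    ⊆-∨ᶠʳ : R ⊆ (S ∨ᶠ R)
    ⊆-∨ᶠʳ {x} x∈R = ⊤ , x , S.⊤∈S , x∈R , x∧y≤y _ _

  D⇒-isFilter : ∀ {u F} → IsFilter A u → IsFilter A F → IsFilter A (D⇒ A u F)
  D⇒-isFilter isU isF = record
    { ⊤∈F      = ⊤ , F.⊤∈F , U.↑-closed (≤-reflexive (sym (⇒-⊤ ⊤))) U.⊤∈F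
    ; ∧-closed = λ (a , a∈F , p) (b , b∈F , q) →
        -- Antitonicity moves both conditionals to the common antecedent `a ∧ b`, where the meet law
        -- combines them.
        a ∧ b , F.∧-closed a∈F b∈F
        , U.↑-closed (≤-reflexive (⇒-∧ _ _ _))
            (U.∧-closed (U.↑-closed (⇒-antiˡ (x∧y≤x _ _)) p)
                        (U.↑-closed (⇒-antiˡ (x∧y≤y _ _)) q))
    ; ↑-closed = λ x≤y (a , a∈F , p) → a , a∈F , U.↑-closed (⇒-monoʳ x≤y) p
    }
    where
    module U = IsFilter isU
    module F = IsFilter isF

  -- If some `f` in `F` were disjoint from `∼ a`, then `f ≤ a` would put `a` in `F`.
  adjoin-∼-proper : ∀ {F a} → IsFilter A F → a ∉ F → ⊥ ∉ (F ∨ᶠ principal (∼ a))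
  adjoin-∼-proper isF a∉F (f , g , f∈F , lift ∼a≤g , f∧g≤⊥) =
    a∉F (IsFilter.↑-closed isF
      (disjoint-∼⇒≤ (≤-trans (∧-mono ≤-refl ∼a≤g) f∧g≤⊥)) f∈F)

  module Ultra (w : Ul A) where
    open IsUltrafilter (proj₂ w) public
    open IsFilter isFilter public

    ∉⇒∼∈ : ∀ {a} → a ∉ proj₁ w → (∼ a) ∈ proj₁ w
    ∉⇒∼∈ {a} a∉w =
      maximal (proj₁ w ∨ᶠ principal (∼ a)) (∨ᶠ-isFilter base base∼a)
        (adjoin-∼-proper isFilter a∉w) (⊆-∨ᶠˡ base base∼a) (⊆-∨ᶠʳ base base∼a (lift ≤-refl))
      where
      base   = filter⇒base isFilter
      base∼a = filter⇒base (principal-isFilter (∼ a))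

    ∼∈⇒∉ : ∀ {a} → (∼ a) ∈ proj₁ w → a ∉ proj₁ w
    ∼∈⇒∉ ∼a∈w a∈w = proper (↑-closed (≤-reflexive (∧-complementʳ _)) (∧-closed a∈w ∼a∈w))

-- Existence of ultrafilters and the Stone topology.

module StoneDuality {c ℓ : Level} (em : ExcludedMiddle (lsuc (c ⊔ ℓ)))
  (zorn : ZornsLemma (lsuc (c ⊔ ℓ))) (A : ConditionalAlgebra c ℓ) where
  open ConditionalAlgebra A
  open ConditionalAlgebraProperties A
  open Filters A

  em₀ : ExcludedMiddle (c ⊔ ℓ)
  em₀ = map′ lower lift (em {Lift _ _})

  module _ {F : Subset A} (isF : IsFilter A F) (⊥∉F : ⊥ ∉ F) where

    ProperExtension : Set (lsuc (c ⊔ ℓ))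
    ProperExtension = ∃[ G ] IsFilter A G × ⊥ ∉ G × F ⊆ G

    extensionPoset : Poset (lsuc (c ⊔ ℓ)) (lsuc (c ⊔ ℓ)) (lsuc (c ⊔ ℓ))
    extensionPoset = record
      { Carrier = ProperExtension
      ; _≈_     = λ G H → Lift _ (proj₁ G ≐ proj₁ H)
      ; _≤_     = λ G H → Lift _ (proj₁ G ⊆ proj₁ H)
      ; isPartialOrder = record
        { isPreorder = record
          { isEquivalence = record
            { refl  = lift (id , id)
            ; sym   = λ (lift (p , q)) → lift (q , p)
            ; trans = λ (lift (p , q)) (lift (r , s)) → lift ((λ x → r (p x)) , (λ x → q (s x)))
            }
          ; reflexive = λ (lift (p , _)) → lift p
          ; trans     = λ (lift p) (lift q) → lift (λ x → q (p x))
          }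
        ; antisym = λ (lift p) (lift q) → lift (p , q)
        }
      }

    -- A union over a family of filters lives one universe too high to be a
    -- Subset; excluded middle replaces membership by its truth value.
    ⋃ᶜ : Pred ProperExtension (lsuc (c ⊔ ℓ)) → Subset A
    ⋃ᶜ C x = Lift (c ⊔ ℓ) (True (em {∃[ G ] G ∈ C × x ∈ proj₁ G}))

    chain-bounded : (C : Pred ProperExtension (lsuc (c ⊔ ℓ))) → IsChain extensionPoset C →
      ∃[ G ] IsUpperBound extensionPoset C G
    chain-bounded C chain with em {∃[ G ] G ∈ C}
    -- An empty chain has no member containing `F`, so `F` itself is the bound.
    ... | no  empty        = (F , isF , ⊥∉F , id) , λ {G} G∈C → ⊥-elim (empty (G , G∈C))
    ... | yes ((G₀ , isG₀ , _ , F⊆G₀) , G₀∈C) =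
      (⋃ᶜ C , union-isFilter , union-proper , λ x∈F → intro G₀∈C (F⊆G₀ x∈F))
      , λ G∈C → lift (intro G∈C)
      where
      intro : ∀ {G x} → G ∈ C → x ∈ proj₁ G → x ∈ ⋃ᶜ C
      intro G∈C x∈G = lift (fromWitness (_ , G∈C , x∈G))

      elim : ∀ {x} → x ∈ ⋃ᶜ C → ∃[ G ] G ∈ C × x ∈ proj₁ G
      elim (lift x∈) = toWitness x∈

      union-proper : ⊥ ∉ ⋃ᶜ C
      union-proper ⊥∈ with elim ⊥∈
      ... | (_ , _ , ⊥∉G , _) , _ , ⊥∈G = ⊥∉G ⊥∈G

      union-∧ : ∀ {x y} → x ∈ ⋃ᶜ C → y ∈ ⋃ᶜ C → (x ∧ y) ∈ ⋃ᶜ C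
      union-∧ x∈ y∈ with elim x∈ | elim y∈
      ... | G , G∈C , x∈G | H , H∈C , y∈H with chain G∈C H∈C
      ...   | inj₁ (lift G⊆H) = intro H∈C (IsFilter.∧-closed (proj₁ (proj₂ H)) (G⊆H x∈G) y∈H)
      ...   | inj₂ (lift H⊆G) = intro G∈C (IsFilter.∧-closed (proj₁ (proj₂ G)) x∈G (H⊆G y∈H))

      union-isFilter : IsFilter A (⋃ᶜ C)
      union-isFilter = record
        { ⊤∈F      = intro G₀∈C (IsFilter.⊤∈F isG₀)
        ; ∧-closed = union-∧
        ; ↑-closed = λ x≤y x∈ → let (G , G∈C , x∈G) = elim x∈ in
            intro G∈C (IsFilter.↑-closed (proj₁ (proj₂ G)) x≤y x∈G)
        }

    -- A proper filter above the Zorn-maximal `u` still contains `F`, so it lies in the poset;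
    -- maximality there is maximality among all proper filters.
    ultrafilter-extension : ∃[ u ] u ∈ φ A F
    ultrafilter-extension with zorn extensionPoset chain-bounded
    ... | (u , isU , ⊥∉u , F⊆u) , max =
      (u , record
        { isFilter = isU
        ; proper   = ⊥∉u
        ; maximal  = λ G isG ⊥∉G u⊆G →
            proj₁ (lower (max {G , isG , ⊥∉G , λ x∈F → u⊆G (F⊆u x∈F)} (lift u⊆G)))
        })
      , F⊆u

  ultrafilter-separation : ∀ {F a} → IsFilter A F → a ∉ F →
    ∃[ u ] u ∈ φ A F × a ∉ proj₁ u
  ultrafilter-separation {F} {a} isF a∉F =
    let base   = filter⇒base isF
        base∼a = filter⇒base (principal-isFilter (∼ a))
        (u , ⊆u) = ultrafilter-extension (∨ᶠ-isFilter base base∼a) (adjoin-∼-proper isF a∉F)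
    in u , (λ x∈F → ⊆u (⊆-∨ᶠˡ base base∼a x∈F))
         , Ultra.∼∈⇒∉ u (⊆u (⊆-∨ᶠʳ base base∼a (lift ≤-refl)))

  -- A filter is the intersection of the ultrafilters above it; this recovers algebraic membership
  -- from the closed set.
  φ⊆⇒∈ : ∀ {F a} → IsFilter A F → (∀ u → u ∈ φ A F → a ∈ proj₁ u) → a ∈ F
  φ⊆⇒∈ isF φF⊆a = decidable-stable em₀ λ a∉F →
    let (u , F⊆u , a∉u) = ultrafilter-separation isF a∉F in a∉u (φF⊆a u F⊆u)

  -- The complement is the union of the basic open sets given by `∼ a` for `a` in `F`.
  φ-closed : ∀ F → TopologicalSpace.IsClosed (stoneSpace A) (φ A F)
  φ-closed F u F⊈u with em₀ {∃[ a ] a ∈ F × a ∉ proj₁ u}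
  ... | yes (a , a∈F , a∉u) = ∼ a , Ultra.∉⇒∼∈ u a∉u , λ v ∼a∈v F⊆v → Ultra.∼∈⇒∉ v ∼a∈v (F⊆v a∈F)
  ... | no  none = ⊥-elim (F⊈u λ {a} a∈F → decidable-stable em₀ λ a∉u → none (a , a∈F , a∉u))

  basic-clopen : ∀ a → TopologicalSpace.IsClopen (stoneSpace A) (λ u → a ∈ proj₁ u)
  basic-clopen a =
      (λ _ a∈u → a , a∈u , λ _ → id)
    , (λ u a∉u → ∼ a , Ultra.∉⇒∼∈ u a∉u , λ v → Ultra.∼∈⇒∉ v)

  -- Ultrafilters agreeing on a Boolean subalgebra.

  module _ {B : Subset A} (isB : IsBooleanSubalgebra A B) where
    private
      module B = IsBooleanSubalgebra isB

      baseB : IsFilterBase B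
      baseB = record { ⊤∈S = B.⊤-closed ; ∧-closed = B.∧-closed }

    -- One inclusion suffices because `B` has complements: if `b` were in `v` but not in `u`, then
    -- `∼ b` would pass from `u` to `v`.
    ⊆-on-B⇒E : ∀ (u v : Ul A) → (∀ {b} → b ∈ B → b ∈ proj₁ u → b ∈ proj₁ v) → E[_] A B u v
    ⊆-on-B⇒E u v u⊆v =
        (λ (b∈u , b∈B) → u⊆v b∈B b∈u , b∈B)
      , (λ (b∈v , b∈B) → decidable-stable em₀ (λ b∉u →
          Ultra.∼∈⇒∉ v (u⊆v (B.∼-closed b∈B) (Ultra.∉⇒∼∈ u b∉u)) b∈v) , b∈B)

    E-transports : ∀ {u v : Subset A} {b} → (u ∩ B) ≐ (v ∩ B) → b ∈ B → b ∈ u → b ∈ v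
    E-transports (p , _) b∈B b∈u = proj₁ (p (b∈u , b∈B))

    agreeing-extension : ∀ {F} (w : Ul A) → IsFilter A F → (F ∩ B) ⊆ proj₁ w →
      ∃[ z ] z ∈ φ A F × E[_] A B z w
    agreeing-extension {F} w isF F∩B⊆w =
      let (z , ⊆z) = ultrafilter-extension (∨ᶠ-isFilter baseF base) join-proper
      in z , (λ x∈F → ⊆z (⊆-∨ᶠˡ baseF base x∈F))
           , swap (⊆-on-B⇒E w z λ b∈B b∈w → ⊆z (⊆-∨ᶠʳ baseF base (b∈w , b∈B)))
      where
      baseF = filter⇒base isF
      base  = ∩-isFilterBase (filter⇒base (Ultra.isFilter w)) baseB

      join-proper : ⊥ ∉ (F ∨ᶠ (proj₁ w ∩ B))
      join-proper (f , b , f∈F , (b∈w , b∈B) , f∧b≤⊥) =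
        -- Disjointness gives `f ≤ ∼ b`, so `∼ b` lies in `F ∩ B` and hence in `w`, against `b ∈ w`.
        Ultra.∼∈⇒∉ w
          (F∩B⊆w (IsFilter.↑-closed isF (disjoint⇒≤∼ f∧b≤⊥) f∈F , B.∼-closed b∈B)) b∈w

    -- The filter generated by the elements of `B` above `a` misses `a`, as otherwise `a` would
    -- equal one of them. An ultrafilter `y` above it omitting `a` therefore meets the extension
    -- condition for the principal filter of `a`, which yields `x`.
    ∉B⇒split : ∀ {a} → a ∉ B → ∃[ x ] ∃[ y ] E[_] A B x y × a ∈ proj₁ x × a ∉ proj₁ y
    ∉B⇒split {a} a∉B =
      let (y , H⊆y , a∉y) = ultrafilter-separation (↑-isFilter base) a∉H
          (x , ↑a⊆x , xEy) = agreeing-extension y (principal-isFilter a)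
            (λ {b} b∈ → H⊆y (b , b∈ , ≤-refl))
      in x , y , xEy , ↑a⊆x (lift ≤-refl) , a∉y
      where
      base = ∩-isFilterBase (filter⇒base (principal-isFilter a)) baseB

      a∉H : a ∉ ↑ (principal a ∩ B)
      a∉H (b , (lift a≤b , b∈B) , b≤a) = a∉B (B.resp-≈ (antisym b≤a a≤b) b∈B)

    E-isBooleanEquivalence : IsBooleanEquivalence (expandedStoneSpace A) (E[_] A B)
    E-isBooleanEquivalence = record
      { isEquivalence = record
        { refl  = id , id
        ; sym   = swap
        ; trans = λ (p , q) (r , s) → (λ x → r (p x)) , (λ x → q (s x))
        }
      ; separates = separates
      }
      where
      separates : ∀ u v → ¬ E[_] A B u v → ∃[ V ]
        TopologicalSpace.IsClopen (stoneSpace A) V ×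
        IsSaturated (expandedStoneSpace A) (E[_] A B) V × u ∈ V × v ∉ V
      separates u v ¬uEv with em₀ {∃[ b ] b ∈ B × b ∈ proj₁ u × b ∉ proj₁ v}
      ... | yes (b , b∈B , b∈u , b∉v) =
        (λ w → b ∈ proj₁ w) , basic-clopen b , (λ xEy → E-transports xEy b∈B) , b∈u , b∉v
      ... | no none = ⊥-elim (¬uEv (⊆-on-B⇒E u v λ {b} b∈B b∈u →
        decidable-stable em₀ λ b∉v → none (b , b∈B , b∈u , b∉v)))

    -- The two implications.

    closed⇒C-equivalence : ClosedUnder⇒ A B → IsCEquivalence (expandedStoneSpace A) (E[_] A B)
    closed⇒C-equivalence ⇒-closed = record
      { isBooleanEquivalence = E-isBooleanEquivalence
      ; back = λ { x x′ y Y _ xEy (F , isF , Y≐φF , D⊆x′) →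
          let G     = ↑ (F ∩ B)
              isG   = ↑-isFilter (∩-isFilterBase (filter⇒base isF) baseB)
              (y′ , D⊆y′ , y′Ex′) = agreeing-extension x′
                (D⇒-isFilter (Ultra.isFilter y) isG)
                (λ { ((a , (g , (g∈F , g∈B) , g≤a) , a⇒b∈y) , b∈B) →
                  -- Lowering the antecedent to `g` in `B` makes `g ⇒ b` an element of `B`, so it
                  -- transfers from `y` to `x`.
                  D⊆x′ (g , g∈F , E-transports (swap xEy) (⇒-closed g∈B b∈B)
                    (Ultra.↑-closed y (⇒-antiˡ g≤a) a⇒b∈y)) })
          in y′ , swap y′Ex′ , φ A G , φ-closed G
           , (G , isG , (id , id) , D⊆y′)
           , λ w G⊆w →
               let (z , F⊆z , zEw) = agreeing-extension w isF (λ {b} b∈ → G⊆w (b , b∈ , ≤-refl))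
               in z , proj₂ Y≐φF F⊆z , zEw }
      }

    C-equivalence⇒closed : IsCEquivalence (expandedStoneSpace A) (E[_] A B) → ClosedUnder⇒ A B
    C-equivalence⇒closed isC {a} {b} a∈B b∈B = decidable-stable em₀ λ a⇒b∉B →
      let (x , y , xEy , a⇒b∈x , a⇒b∉y) = ∉B⇒split a⇒b∉B
          is↑a = principal-isFilter a
          (y′ , D⊆y′ , b∉y′) = ultrafilter-separation
            (D⇒-isFilter (Ultra.isFilter y) is↑a)
            -- A witness `a′ ≥ a` for `b` would force `a ⇒ b` into `y` by antitonicity.
            (λ { (a′ , lift a≤a′ , a′⇒b∈y) → a⇒b∉y (Ultra.↑-closed y (⇒-antiˡ a≤a′) a′⇒b∈y) })
          -- The back condition is used from `y` to `x`, reversing the roles of the two points.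
          (x′ , y′Ex′ , C , _ , (G , isG , C≐φG , D⊆x′) , C⪯φ↑a) =
            IsCEquivalence.back isC y y′ x (φ A (principal a)) (φ-closed (principal a))
              (swap xEy) (principal a , is↑a , (id , id) , D⊆y′)
          -- Each `w` above `G` agrees on `B` with some `z` containing `a`; as `a` is in `B`, it
          -- lies in every such `w`.
          a∈G = φ⊆⇒∈ isG λ w G⊆w →
            let (z , ↑a⊆z , zEw) = C⪯φ↑a w (proj₂ C≐φG G⊆w)
            in E-transports zEw a∈B (↑a⊆z (lift ≤-refl))
      in b∉y′ (E-transports (swap y′Ex′) b∈B (D⊆x′ (a , a∈G , a⇒b∈x)))

theorem7p5 : ∀ {c ℓ} → ExcludedMiddle (lsuc (c ⊔ ℓ)) → ZornsLemma (lsuc (c ⊔ ℓ)) →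
    (A : ConditionalAlgebra c ℓ) (B : Subset A) → IsBooleanSubalgebra A B →
    IsCEquivalence (expandedStoneSpace A) (E[_] A B) ⇔ ClosedUnder⇒ A B
theorem7p5 em zorn A B isB = mk⇔ (C-equivalence⇒closed isB) (closed⇒C-equivalence isB)
  where open StoneDuality em zorn A
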